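{- Let $k \geq 2$ be an integer. Then: (i) $T_n(k) = \sum_{j=1}^{k-1} B_n(k,j)$ for all $n \geq 0$. (ii) $S_n(k) = \sum_{j=0}^{k-1} B_n(k,j)$ for all $n \geq 0$. (iii) For every integer $j$ with $0 \leq j \leq k-1$, $B_n(k,j) = \frac{1}{k-1} \left(S_n(k) - S_{n-j-1}(k)\right)$ for all $n \geq j+1$.
   Context: Fix an integer $k \geq 2$. All of the following sequences satisfy the $k$-order Fibonacci recurrence $X_n = X_{n-1}+X_{n-2}+\dots+X_{n-k}$ for all $n \geq k$, and are determined by their first $k$ terms (indices $0,\dots,k-1$): $\{T_n(k)\}_{n \geq 0}$ has first $k$ terms $(0,1,1,\dots,1)$; $\{S_n(k)\}_{n \geq 0}$ has first $k$ terms $(1,1,\dots,1)$; and, for $0 \leq j \leq k-1$, $\{B_n(k,j)\}_{n\geq 0}$ has $B_j(k,j)=1$ and $B_i(k,j)=0$ for $0 \leq i \leq k-1$, $i\neq j$. -}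

module Defs where

open import Data.Bool.Base using (if_then_else_)
open import Data.Integer.Base using (+_)
open import Data.List.Base using (List; []; _∷_; take; applyUpTo)
open import Data.Nat.Base using (ℕ; zero; suc; _+_; _∸_; _≤_; _<_; _≡ᵇ_; s≤s)
open import Data.Nat.ListAction using (sum)
open import Data.Nat.Properties using (_<?_; ≤⇒≯)
open import Data.Rational.Base using (ℚ; _/_)
open import Relation.Binary.PropositionalEquality using (_≡_; refl; cong)
open import Relation.Nullary using (yes; no; contradiction)

sumFromTo : ℕ → ℕ → (ℕ → ℕ) → ℕ
sumFromTo a b f = sum (applyUpTo (λ i → f (a + i)) (suc b ∸ a))

infixr 5 sumFromTo
syntax sumFromTo a b (λ j → x) = ∑[ j from a to b ] x

toℚ : ℕ → ℚ
toℚ n = + n / 1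

-- The k-order Fibonacci sequence with first k terms init 0, …, init (k ∸ 1);
-- later values of init are ignored.

module _ (k : ℕ) (init : ℕ → ℕ) where

  mutual

    fibonacci : ℕ → ℕ
    fibonacci n with n <? k
    ... | yes _ = init n
    ... | no  _ = sum (take k (previous n))

    -- previous n = X (n ∸ 1) ∷ X (n ∸ 2) ∷ … ∷ X 0 ∷ []  for  X = fibonacci
    previous : ℕ → List ℕ
    previous zero    = []
    previous (suc n) = fibonacci n ∷ previous n

  fibonacci-init : ∀ n → n < k → fibonacci n ≡ init n
  fibonacci-init n n<k with n <? k
  ... | yes _  = refl
  ... | no n≮k = contradiction n<k n≮k

  take-previous : ∀ m n → m ≤ n →
    take m (previous n) ≡ applyUpTo (λ i → fibonacci (n ∸ suc i)) m
  take-previous zero    n       _         = refl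
  take-previous (suc m) (suc n) (s≤s m≤n) = cong (fibonacci n ∷_) (take-previous m n m≤n)

  fibonacci-rec : ∀ n → k ≤ n → fibonacci n ≡ ∑[ i from 1 to k ] fibonacci (n ∸ i)
  fibonacci-rec n k≤n with n <? k
  ... | yes n<k = contradiction n<k (≤⇒≯ k≤n)
  ... | no  _   = cong sum (take-previous k n k≤n)

T : ℕ → ℕ → ℕ
T k = fibonacci k (λ i → if i ≡ᵇ 0 then 0 else 1)

S : ℕ → ℕ → ℕ
S k = fibonacci k (λ _ → 1)

-- B k j n is Bₙ(k,j), meaningful only for j < k.
B : ℕ → ℕ → ℕ → ℕ
B k j = fibonacci k (λ i → if i ≡ᵇ j then 1 else 0)

{-# OPTIONS --safe #-}
-- Solutions of the recurrence are closed under sums, scalar multiples and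
-- shifts, and are determined by their first k terms.  For (iii), both sides of
--   (k − 1) B_{j+1+m}(k,j) + S_m(k) = S_{j+1+m}(k)
-- are therefore solutions in m, and only m < k remains; there S_m(k) = 1, and
-- the doubling rule X_{n+1} + X_{n−k} = 2 X_n handles the indices beyond k.
module Submission where

open import Data.Bool.Base using (if_then_else_)
open import Data.Integer.Base as ℤ using (+_)
import Data.Integer.Properties as ℤ
import Data.Integer.Solver as ℤ
open import Data.List.Base using (applyUpTo; _∷ʳ_)
open import Data.List.Properties using (applyUpTo-∷ʳ)
open import Data.Nat.Base
  using (ℕ; zero; suc; _+_; _∸_; _≤_; _<_; _≥_; _≡ᵇ_; z≤n; s≤s; NonZero; >-nonZero)
  renaming (_*_ to _*ℕ_)
open import Data.Nat.Induction using (<-rec)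
open import Data.Nat.ListAction using (sum)
open import Data.Nat.ListAction.Properties using (sum-++)
open import Data.Nat.Properties
open import Data.Nat.Solver using (module +-*-Solver)
open import Data.Product.Base using (_×_; _,_)
open import Data.Rational.Base as ℚ using (_/_; _*_; _-_; toℚᵘ)
import Data.Rational.Properties as ℚ
open import Data.Rational.Unnormalised.Base as ℚᵘ using (mkℚᵘ; *≡*)
import Data.Rational.Unnormalised.Properties as ℚᵘ
open import Relation.Binary.Definitions using (tri<; tri≈; tri>)
open import Relation.Binary.PropositionalEquality
open import Relation.Nullary using (yes; no; contradiction)
open import Defs

open ≡-Reasoning

private
  variable
    f g X Y : ℕ → ℕ

-- Finite sums of natural numbers.

sum-cong : ∀ m → (∀ {i} → i < m → f i ≡ g i) → sum (applyUpTo f m) ≡ sum (applyUpTo g m)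
sum-cong zero    f≗g = refl
sum-cong (suc m) f≗g = cong₂ _+_ (f≗g (s≤s z≤n)) (sum-cong m λ i<m → f≗g (s≤s i<m))

sum-const : ∀ c m → sum (applyUpTo (λ _ → c) m) ≡ m *ℕ c
sum-const c zero    = refl
sum-const c (suc m) = cong (_+_ c) (sum-const c m)

sum-0 : ∀ m → sum (applyUpTo (λ _ → 0) m) ≡ 0
sum-0 m = trans (sum-const 0 m) (*-zeroʳ m)

sum-+ : ∀ f g m →
  sum (applyUpTo (λ i → f i + g i) m) ≡ sum (applyUpTo f m) + sum (applyUpTo g m)
sum-+ f g zero    = refl
sum-+ f g (suc m) = trans
  (cong (_+_ (f 0 + g 0)) (sum-+ (λ i → f (suc i)) (λ i → g (suc i)) m))
  (solve 4 (λ a b c d → (a :+ b) :+ (c :+ d) := (a :+ c) :+ (b :+ d)) refl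
    (f 0) (g 0) (sum (applyUpTo (λ i → f (suc i)) m)) (sum (applyUpTo (λ i → g (suc i)) m)))
  where open +-*-Solver

sum-* : ∀ c f m → sum (applyUpTo (λ i → c *ℕ f i) m) ≡ c *ℕ sum (applyUpTo f m)
sum-* c f zero    = sym (*-zeroʳ c)
sum-* c f (suc m) = trans
  (cong (_+_ (c *ℕ f 0)) (sum-* c (λ i → f (suc i)) m))
  (sym (*-distribˡ-+ c (f 0) _))

sum-last : ∀ f m → sum (applyUpTo f (suc m)) ≡ sum (applyUpTo f m) + f m
sum-last f m = begin
  sum (applyUpTo f (suc m))        ≡⟨ cong sum (applyUpTo-∷ʳ f m) ⟨
  sum (applyUpTo f m ∷ʳ f m)       ≡⟨ sum-++ (applyUpTo f m) _ ⟩
  sum (applyUpTo f m) + (f m + 0)  ≡⟨ cong (_+_ (sum (applyUpTo f m))) (+-identityʳ (f m)) ⟩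
  sum (applyUpTo f m) + f m        ∎

-- The recurrence lists earlier terms from the latest down; this turns such a sum into one in
-- increasing order of index.
sum-reverse : ∀ f m → sum (applyUpTo (λ i → f (m ∸ suc i)) m) ≡ sum (applyUpTo f m)
sum-reverse f zero    = refl
sum-reverse f (suc m) = begin
  f m + sum (applyUpTo (λ i → f (m ∸ suc i)) m)  ≡⟨ cong (_+_ (f m)) (sum-reverse f m) ⟩
  f m + sum (applyUpTo f m)                      ≡⟨ +-comm (f m) _ ⟩
  sum (applyUpTo f m) + f m                      ≡⟨ sum-last f m ⟨
  sum (applyUpTo f (suc m))                      ∎

-- Kronecker delta, with the same body as the initial values in `B`, so that `fibonacci-init` speaks
-- of `δ` directly.
δ : ℕ → ℕ → ℕ
δ i j = if i ≡ᵇ j then 1 else 0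

δ-≢ : ∀ i j → i ≢ j → δ i j ≡ 0
δ-≢ zero    zero    i≢j = contradiction refl i≢j
δ-≢ zero    (suc j) i≢j = refl
δ-≢ (suc i) zero    i≢j = refl
δ-≢ (suc i) (suc j) i≢j = δ-≢ i j λ i≡j → i≢j (cong suc i≡j)

δ-comm : ∀ i j → δ i j ≡ δ j i
δ-comm zero    zero    = refl
δ-comm zero    (suc j) = refl
δ-comm (suc i) zero    = refl
δ-comm (suc i) (suc j) = δ-comm i j

sum-δ : ∀ {i m} → i < m → sum (applyUpTo (δ i) m) ≡ 1
sum-δ {zero}  {suc m} _         = cong suc (sum-0 m)
sum-δ {suc i} {suc m} (s≤s i<m) = sum-δ i<m

-- The solutions of the recurrence.

Recurrent : ℕ → (ℕ → ℕ) → Set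
Recurrent k X = ∀ n → k ≤ n → X n ≡ ∑[ i from 1 to k ] X (n ∸ i)

module _ {k : ℕ} where

  Recurrent-0 : Recurrent k (λ _ → 0)
  Recurrent-0 n k≤n = sym (sum-0 k)

  Recurrent-+ : Recurrent k X → Recurrent k Y → Recurrent k (λ n → X n + Y n)
  Recurrent-+ {X} {Y} recX recY n k≤n = trans
    (cong₂ _+_ (recX n k≤n) (recY n k≤n))
    (sym (sum-+ (λ i → X (n ∸ suc i)) (λ i → Y (n ∸ suc i)) k))

  Recurrent-* : ∀ c → Recurrent k X → Recurrent k (λ n → c *ℕ X n)
  Recurrent-* {X} c recX n k≤n = trans
    (cong (_*ℕ_ c) (recX n k≤n)) (sym (sum-* c (λ i → X (n ∸ suc i)) k))

  Recurrent-sum : ∀ (F : ℕ → ℕ → ℕ) m → (∀ j → Recurrent k (F j)) →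
    Recurrent k (λ n → sum (applyUpTo (λ j → F j n) m))
  Recurrent-sum F zero    recF = Recurrent-0
  Recurrent-sum F (suc m) recF =
    Recurrent-+ (recF 0) (Recurrent-sum (λ j → F (suc j)) m λ j → recF (suc j))

  Recurrent-shift : ∀ s → Recurrent k X → Recurrent k (λ n → X (s + n))
  Recurrent-shift {X} s recX n k≤n = trans
    (recX (s + n) (m≤n⇒m≤o+n s k≤n))
    -- Here `suc i ≤ k ≤ n`, so the subtraction does not truncate and `s` may be moved out of it.
    (sum-cong k λ i<k → cong X (+-∸-assoc s (≤-trans i<k k≤n)))

  Recurrent-unique : Recurrent k X → Recurrent k Y →
    (∀ n → n < k → X n ≡ Y n) → ∀ n → X n ≡ Y n
  Recurrent-unique {X} {Y} recX recY init = <-rec _ step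
    where
    step : ∀ n → (∀ {m} → m < n → X m ≡ Y m) → X n ≡ Y n
    step n ih with n <? k
    ... | yes n<k = init n n<k
    ... | no  n≮k = begin
      X n                                      ≡⟨ recX n k≤n ⟩
      sum (applyUpTo (λ i → X (n ∸ suc i)) k)  ≡⟨ sum-cong k (λ i<k → ih (∸-monoʳ-< (s≤s z≤n) (≤-trans i<k k≤n))) ⟩
      sum (applyUpTo (λ i → Y (n ∸ suc i)) k)  ≡⟨ recY n k≤n ⟨
      Y n                                      ∎
      where k≤n = ≮⇒≥ n≮k

  -- The `k` terms before index `suc n`, followed by `X (n ∸ k)`, are `X n` followed by the `k`
  -- terms before index `n`. The latter sum to `X n` again.
  Recurrent-doubling : Recurrent k X → ∀ n → k ≤ n → X (suc n) + X (n ∸ k) ≡ X n + X n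
  Recurrent-doubling {X} recX n k≤n = begin
    X (suc n) + X (n ∸ k)                            ≡⟨ cong (_+ X (n ∸ k)) (recX (suc n) (m≤n⇒m≤1+n k≤n)) ⟩
    sum (applyUpTo (λ i → X (n ∸ i)) k) + X (n ∸ k)  ≡⟨ sum-last (λ i → X (n ∸ i)) k ⟨
    X n + sum (applyUpTo (λ i → X (n ∸ suc i)) k)    ≡⟨ cong (_+_ (X n)) (recX n k≤n) ⟨
    X n + X n                                        ∎

  -- At index `k` the recurrence runs over exactly the initial terms, in reverse. This gives the
  -- values of `S` and `B` at `k`.
  Recurrent-first : Recurrent k X → X k ≡ sum (applyUpTo X k)
  Recurrent-first {X} recX = trans (recX k ≤-refl) (sum-reverse X k)

-- Parts (i) and (ii): sums of the basis sequences.

T-init : ∀ {m n} → n ≤ m → (if n ≡ᵇ 0 then 0 else 1) ≡ sum (applyUpTo (λ j → δ n (suc j)) m)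
-- No `suc j` equals `0`, so every summand vanishes; a positive index is hit exactly once, since
-- `δ (suc n) (suc j)` computes to `δ n j`.
T-init {m} {zero}  _   = sym (sum-0 m)
T-init {m} {suc n} n<m = sym (sum-δ n<m)

T-sum : ∀ m n → T (suc m) n ≡ ∑[ j from 1 to m ] B (suc m) j n
T-sum m = Recurrent-unique
  (fibonacci-rec k _)
  (Recurrent-sum (λ j → B k (suc j)) m λ j → fibonacci-rec k _)
  λ n n<k → begin
    T k n                                    ≡⟨ fibonacci-init k _ n n<k ⟩
    (if n ≡ᵇ 0 then 0 else 1)                ≡⟨ T-init (≤-pred n<k) ⟩
    sum (applyUpTo (λ j → δ n (suc j)) m)    ≡⟨ sum-cong m (λ _ → fibonacci-init k _ n n<k) ⟨
    sum (applyUpTo (λ j → B k (suc j) n) m)  ∎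
  where k = suc m

S-sum : ∀ k n → S k n ≡ sum (applyUpTo (λ j → B k j n) k)
S-sum k = Recurrent-unique
  (fibonacci-rec k _)
  (Recurrent-sum (B k) k λ j → fibonacci-rec k _)
  λ n n<k → begin
    S k n                              ≡⟨ fibonacci-init k _ n n<k ⟩
    1                                  ≡⟨ sum-δ n<k ⟨
    sum (applyUpTo (δ n) k)            ≡⟨ sum-cong k (λ _ → fibonacci-init k _ n n<k) ⟨
    sum (applyUpTo (λ j → B k j n) k)  ∎

-- Part (iii) over the natural numbers.

S-first : ∀ k → S k k ≡ k
S-first k = begin
  S k k                        ≡⟨ Recurrent-first (fibonacci-rec k _) ⟩
  sum (applyUpTo (S k) k)      ≡⟨ sum-cong k (fibonacci-init k _ _) ⟩
  sum (applyUpTo (λ _ → 1) k)  ≡⟨ sum-const 1 k ⟩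
  k *ℕ 1                       ≡⟨ *-identityʳ k ⟩
  k                            ∎

B-first : ∀ {k j} → j < k → B k j k ≡ 1
B-first {k} {j} j<k = begin
  B k j k                    ≡⟨ Recurrent-first (fibonacci-rec k _) ⟩
  -- The initial values of `B` vary the first argument of `δ`, whereas `sum-δ` sums over the second.
  sum (applyUpTo (B k j) k)  ≡⟨ sum-cong k (λ {i} i<k → trans (fibonacci-init k _ i i<k) (δ-comm i j)) ⟩
  sum (applyUpTo (δ j) k)    ≡⟨ sum-δ j<k ⟩
  1                          ∎

B-init-≢ : ∀ {k j n} → n < k → n ≢ j → B k j n ≡ 0
B-init-≢ {k} n<k n≢j = trans (fibonacci-init k _ _ n<k) (δ-≢ _ _ n≢j)

-- One application of the doubling rule to `B` and `S` at once. The `0` and the `1` in the first two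
-- hypotheses are their terms at `n ∸ k`. Doubling `c *ℕ b + 1 ≡ s` then gives the claim with an
-- extra `1` on each side, which cancels.
double-affine : ∀ c {b b′ s s′} → b′ + 0 ≡ b + b → s′ + 1 ≡ s + s → c *ℕ b + 1 ≡ s →
  c *ℕ b′ + 1 ≡ s′
double-affine c {b} {b′} {s′ = s′} b-eq s-eq refl = +-cancelʳ-≡ 1 _ _ (begin
  c *ℕ b′ + 1 + 1              ≡⟨ cong (λ x → c *ℕ x + 1 + 1) (trans (sym (+-identityʳ b′)) b-eq) ⟩
  c *ℕ (b + b) + 1 + 1         ≡⟨ solve 2 (λ c b → c :* (b :+ b) :+ con 1 :+ con 1
                                              := (c :* b :+ con 1) :+ (c :* b :+ con 1)) refl c b ⟩
  (c *ℕ b + 1) + (c *ℕ b + 1)  ≡⟨ s-eq ⟨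
  s′ + 1                       ∎)
  where open +-*-Solver

-- In this range `n ∸ suc j` is less than `k = suc m`, so the summand `1` is the value of `S` there.
-- The proof is by induction on `n`, with cases by its position relative to `k`.
B-S-window : ∀ m {j} → j ≤ m → ∀ n → j < n → n ≤ j + suc m → m *ℕ B (suc m) j n + 1 ≡ S (suc m) n
B-S-window m {j} j≤m (suc n) j<1+n 1+n≤j+k with <-cmp (suc n) (suc m)
... | tri< 1+n<k _ _ = begin
  m *ℕ B (suc m) j (suc n) + 1  ≡⟨ cong (λ b → m *ℕ b + 1) (B-init-≢ 1+n<k (>⇒≢ j<1+n)) ⟩
  m *ℕ 0 + 1                    ≡⟨ cong (_+ 1) (*-zeroʳ m) ⟩
  1                             ≡⟨ fibonacci-init (suc m) _ (suc n) 1+n<k ⟨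
  S (suc m) (suc n)             ∎
-- At index `k`, `B` adds up a single one and `S` adds up `k` ones.
... | tri≈ _ refl _ = begin
  m *ℕ B (suc m) j (suc m) + 1  ≡⟨ cong (λ b → m *ℕ b + 1) (B-first (s≤s j≤m)) ⟩
  m *ℕ 1 + 1                    ≡⟨ cong (_+ 1) (*-identityʳ m) ⟩
  m + 1                         ≡⟨ +-comm m 1 ⟩
  suc m                         ≡⟨ S-first (suc m) ⟨
  S (suc m) (suc m)             ∎
-- Beyond `k`, the upper bound of the window forces `n ∸ k < j`, so the term that doubling drops is
-- `0` for `B` and `1` for `S`.
... | tri> _ _ (s≤s k≤n) = double-affine m
  (subst (λ x → B k j (suc n) + x ≡ B k j n + B k j n) (B-init-≢ n∸k<k (<⇒≢ n∸k<j))
    (Recurrent-doubling (fibonacci-rec k _) n k≤n))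
  (subst (λ x → S k (suc n) + x ≡ S k n + S k n) (fibonacci-init k _ (n ∸ k) n∸k<k)
    (Recurrent-doubling (fibonacci-rec k _) n k≤n))
  (B-S-window m j≤m n (≤-trans (s≤s j≤m) k≤n) (<⇒≤ 1+n≤j+k))
  where
  k = suc m
  n∸k<j : n ∸ k < j
  n∸k<j = +-cancelʳ-< k (n ∸ k) j (subst (_< j + k) (sym (m∸n+n≡m k≤n)) 1+n≤j+k)
  n∸k<k : n ∸ k < k
  n∸k<k = <-≤-trans n∸k<j (m≤n⇒m≤1+n j≤m)

B-S-shift : ∀ m {j} → j ≤ m → ∀ n →
  m *ℕ B (suc m) j (suc j + n) + S (suc m) n ≡ S (suc m) (suc j + n)
B-S-shift m {j} j≤m = Recurrent-unique
  (Recurrent-+ (Recurrent-* m (Recurrent-shift (suc j) (fibonacci-rec k _))) (fibonacci-rec k _))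
  (Recurrent-shift (suc j) (fibonacci-rec k _))
  λ n n<k → begin
    m *ℕ B k j (suc j + n) + S k n  ≡⟨ cong (_+_ (m *ℕ B k j (suc j + n))) (fibonacci-init k _ n n<k) ⟩
    -- The upper bound of the window holds because `suc j + n` equals `j + suc n` and `suc n ≤ k`.
    m *ℕ B k j (suc j + n) + 1      ≡⟨ B-S-window m j≤m (suc j + n) (m≤m+n (suc j) n)
                                        (subst (_≤ j + k) (+-suc j n) (+-monoʳ-≤ j n<k)) ⟩
    S k (suc j + n)                 ∎
  where k = suc m

-- Normalised fractions do not compute on variables. The equation is therefore carried along the
-- injective homomorphism `toℚᵘ` to unnormalised fractions, where equality is cross-multiplication
-- of integers.
toℚ-solve : ∀ m .{{_ : NonZero m}} {b s t} → m *ℕ b + t ≡ s →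
  toℚ b ≡ (+ 1 / m) * (toℚ s - toℚ t)
toℚ-solve m@(suc l) {b} {_} {t} refl = ℚ.toℚᵘ-injective (begin-equality
  toℚᵘ (toℚ b)
    ≃⟨ toℚᵘ-toℚ b ⟩
  mkℚᵘ (+ b) 0
    ≃⟨ *≡* (clear +s (cong +_ (*-identityʳ m))) ⟩
  mkℚᵘ (+ 1) l ℚᵘ.* (mkℚᵘ (+ s) 0 ℚᵘ.- mkℚᵘ (+ t) 0)
    ≃⟨ ℚᵘ.*-cong (ℚ.toℚᵘ-fromℚᵘ (mkℚᵘ (+ 1) l))
                 (ℚᵘ.+-cong (toℚᵘ-toℚ s) (ℚᵘ.-‿cong (toℚᵘ-toℚ t))) ⟨
  toℚᵘ (+ 1 / m) ℚᵘ.* (toℚᵘ (toℚ s) ℚᵘ.- toℚᵘ (toℚ t))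
    ≃⟨ ℚᵘ.*-congˡ {toℚᵘ (+ 1 / m)} (ℚᵘ.+-congʳ (toℚᵘ (toℚ s)) (ℚ.toℚᵘ-homo‿- (toℚ t))) ⟨
  toℚᵘ (+ 1 / m) ℚᵘ.* (toℚᵘ (toℚ s) ℚᵘ.+ toℚᵘ (ℚ.- toℚ t))
    ≃⟨ ℚᵘ.*-congˡ {toℚᵘ (+ 1 / m)} (ℚ.toℚᵘ-homo-+ (toℚ s) (ℚ.- toℚ t)) ⟨
  toℚᵘ (+ 1 / m) ℚᵘ.* toℚᵘ (toℚ s - toℚ t)
    ≃⟨ ℚ.toℚᵘ-homo-* (+ 1 / m) (toℚ s - toℚ t) ⟨
  toℚᵘ ((+ 1 / m) * (toℚ s - toℚ t))
    □)
  where
  open ℚᵘ.≤-Reasoning using (begin-equality_; step-≃-⟩; step-≃-⟨) renaming (_∎ to _□)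
  s = m *ℕ b + t
  toℚᵘ-toℚ : ∀ n → toℚᵘ (toℚ n) ℚᵘ.≃ mkℚᵘ (+ n) 0
  toℚᵘ-toℚ n = ℚ.toℚᵘ-fromℚᵘ (mkℚᵘ (+ n) 0)
  +s : + s ≡ + m ℤ.* + b ℤ.+ + t
  +s = trans (ℤ.pos-+ (m *ℕ b) t) (cong (ℤ._+ + t) (ℤ.pos-* m b))
  -- The cross-multiplied equation, with `x` for the numerator `+ s` and `d` for the denominator of
  -- the product. As variables they can be replaced by ring expressions, which leaves an identity
  -- for the solver.
  clear : ∀ {x d} → x ≡ + m ℤ.* + b ℤ.+ + t → d ≡ + m →
    + b ℤ.* d ≡ (+ 1 ℤ.* (x ℤ.* + 1 ℤ.+ ℤ.- (+ t) ℤ.* + 1)) ℤ.* + 1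
  clear refl refl =
    solve 3 (λ b m t → b :* m
        := (con (+ 1) :* ((m :* b :+ t) :* con (+ 1) :+ (:- t) :* con (+ 1))) :* con (+ 1))
      refl (+ b) (+ m) (+ t)
    where open ℤ.+-*-Solver

lemma3 : (k : ℕ) (k≥2 : k ≥ 2) →
    (∀ n → T k n ≡ ∑[ j from 1 to k ∸ 1 ] B k j n)
    × (∀ n → S k n ≡ ∑[ j from 0 to k ∸ 1 ] B k j n)
    × (∀ j → j ≤ k ∸ 1 → ∀ n → n ≥ suc j →
    toℚ (B k j n)
    ≡ (_/_ (+ 1) (k ∸ 1) {{>-nonZero (m<n⇒0<n∸m k≥2)}})
    * (toℚ (S k n) - toℚ (S k (n ∸ j ∸ 1))))
lemma3 k@(suc m@(suc _)) (s≤s (s≤s z≤n)) = T-sum m , S-sum k , λ j j≤m n j<n →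
  toℚ-solve m {B k j n} {S k n} {S k (n ∸ j ∸ 1)} (shifted j≤m j<n)
  where
  shifted : ∀ {j n} → j ≤ m → j < n → m *ℕ B k j n + S k (n ∸ j ∸ 1) ≡ S k n
  shifted {j} {n} j≤m j<n
    -- Merges the two subtractions into `n ∸ suc j`, the shift variable of `B-S-shift`; `j < n`
    -- ensures that adding `suc j` back gives `n`.
    rewrite ∸-+-assoc n j 1 | +-comm j 1 =
    subst (λ x → m *ℕ B k j x + S k (n ∸ suc j) ≡ S k x) (m+[n∸m]≡n j<n)
      (B-S-shift m j≤m (n ∸ suc j))
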